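{- Let $(a_i)_{i=1}^n$ and $(b_i)_{i=1}^n$ be two sequences of nonnegative integers such that $(a_i)_{i=1}^n$ majorizes $(b_i)_{i=1}^n$. Then $$P'(a_1,a_2,\ldots,a_n)\le P'(b_1,b_2,\ldots,b_n).$$
   Context: $P'(t_1,\dots,t_n)$ is the number of anagrams without fixed letters of the word $1^{t_1}2^{t_2}\cdots n^{t_n}$, i.e. the number of words $a_{1,1}\ldots a_{1,t_1}\ldots a_{n,1}\ldots a_{n,t_n}$ that are rearrangements of $1^{t_1}\cdots n^{t_n}$ with $a_{i,j}\neq i$ for all $i,j$. A sequence $(a_i)_{i=1}^n$ majorizes $(b_i)_{i=1}^n$ if $\sum a_i=\sum b_i$ and, after sorting both in nonincreasing order, every partial sum of the first $k$ terms of $(a_i)$ is at least the corresponding partial sum of $(b_i)$. -}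

module Defs where

open import Data.Nat using (ℕ; zero; suc; _≤_)
open import Data.Nat.Properties using (≤-decTotalOrder)
open import Data.Fin using (Fin; _≟_)
open import Data.Vec using (Vec; toList; lookup)
open import Data.List using (List; []; _∷_; length; filterᵇ; concatMap; map; replicate; take; reverse; allFin)
open import Data.Nat.ListAction using (sum)
open import Data.Product using (_×_)
open import Data.Bool using (Bool; true; false; _∧_; not)
open import Relation.Nullary.Decidable using (⌊_⌋)
open import Relation.Binary.PropositionalEquality using (_≡_)
open import Data.Nat.Base renaming (_≡ᵇ_ to _==_) using ()
import Data.List.Sort as Sort

baseWord : {n : ℕ} → Vec ℕ n → List (Fin n)
baseWord {n} t = concatMap (λ i → replicate (lookup t i) i) (allFin n)

allWords : (n L : ℕ) → List (List (Fin n))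
allWords n zero = [] ∷ []
allWords n (suc L) = concatMap (λ i → map (i ∷_) (allWords n L)) (allFin n)

count : {n : ℕ} → Fin n → List (Fin n) → ℕ
count i u = length (filterᵇ (λ j → ⌊ j ≟ i ⌋) u)

isRearrangement : {n : ℕ} → Vec ℕ n → List (Fin n) → Bool
isRearrangement {n} t u = allB (allFin n)
  where
  allB : List (Fin n) → Bool
  allB [] = true
  allB (i ∷ is) = (count i u == lookup t i) ∧ allB is

noFixed : {n : ℕ} → List (Fin n) → List (Fin n) → Bool
noFixed [] [] = true
noFixed (x ∷ xs) (y ∷ ys) = not ⌊ x ≟ y ⌋ ∧ noFixed xs ys
noFixed _ _ = false

P′ : {n : ℕ} → Vec ℕ n → ℕ
P′ {n} t = length (filterᵇ (λ u → isRearrangement t u ∧ noFixed u w) (allWords n (length w)))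
  where
  w = baseWord t

sortDesc : List ℕ → List ℕ
sortDesc xs = reverse (Sort.sort ≤-decTotalOrder xs)

Majorizes : {n : ℕ} → Vec ℕ n → Vec ℕ n → Set
Majorizes {n} a b =
  (sum (toList a) ≡ sum (toList b)) ×
  ((k : ℕ) → k ≤ n → sum (take k (sortDesc (toList b))) ≤ sum (take k (sortDesc (toList a))))

{-# OPTIONS --safe #-}

-- P′(t) is the coefficient of x^t in ∏ₖ (S − xₖ)^(tₖ), where S = ∑ₖ xₖ. Single out two letters with variables x, y
-- and multiplicities p, q, and let z be the sum of the other variables. The two letters contribute the factor
-- (y+z)^p (x+z)^q, and all other factors depend on x and y only through x + y. Hence P′ is a combination, with
-- nonnegative coefficients independent of p and q, of the numbers
--   c(p,q,m) = [x^p y^q z^m] (y+z)^p (x+z)^q (x+y)^m.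
-- The identity (y+z)(x+z)(x+y) = 2xyz + xy(x+y) + xz(x+z) + yz(y+z) gives
--   c(p+1,q+1,m+1) = c(p,q,m+1) + c(p,q+1,m) + c(p+1,q,m) + 2c(p,q,m),
-- from which c is symmetric in p, q and c(p+1,q,m) ≤ c(p,q+1,m) for q ≤ p. So P′ does not decrease when a unit is
-- moved from a larger multiplicity to a smaller one, and such moves lead from a to any b that it majorizes.

module Submission where

open import Defs
open import Data.Nat using (ℕ; zero; suc; _+_; _*_; _∸_; _≤_; _<_; z≤n; s≤s; s≤s⁻¹; _≡ᵇ_; _≤?_)
open import Data.Nat.Properties hiding (_≟_; _≤?_)
open import Data.Nat.ListAction using (sum)
open import Data.Nat.ListAction.Properties using (sum-↭)
open import Data.Nat.Tactic.RingSolver using (solve-∀)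
open import Data.Bool using (Bool; true; false; _∧_; if_then_else_)
open import Data.Bool.Properties using (∧-zeroʳ)
open import Data.Fin using (Fin; zero; suc; _≟_)
import Data.Fin.Properties as Fin
open import Data.Vec using (Vec; []; _∷_; lookup; _[_]≔_; toList; fromList)
open import Data.Vec.Properties using (lookup∘update; lookup∘update′; []≔-idempotent; []≔-commutes; length-toList)
open import Data.List using (List; []; _∷_; _++_; length; filterᵇ; concatMap; map; replicate; take; reverse; allFin; tabulate)
open import Data.List.Properties using (concatMap-cong; concatMap-map; map-concatMap; map-tabulate; map-replicate; unfold-reverse)
open import Data.List.Membership.Propositional using (_∈_)
open import Data.List.Membership.Propositional.Properties using (∈-allFin)
open import Data.List.Relation.Unary.Any using (here; there)
open import Data.List.Relation.Unary.All as All using (All; []; _∷_)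
import Data.List.Relation.Unary.All.Properties as All
open import Data.List.Relation.Unary.AllPairs using (AllPairs; []; _∷_)
import Data.List.Relation.Unary.AllPairs.Properties as AllPairs
open import Data.List.Relation.Unary.Sorted.TotalOrder.Properties using (Sorted⇒AllPairs)
open import Data.List.Relation.Binary.Permutation.Propositional using (_↭_; prep; swap; ↭-refl; ↭-sym; ↭-trans; ↭-reflexive)
open import Data.List.Relation.Binary.Permutation.Propositional.Properties using (map⁺; ++⁺ˡ; ↭-reverse; ↭-length; All-resp-↭) renaming (shift to ↭-shift)
open import Data.List.Sort ≤-decTotalOrder using (sort; sort-↭; sort-↗)
open import Data.Product using (Σ; ∃; _×_; _,_)
open import Data.Sum using (_⊎_; inj₁; inj₂)
open import Data.Empty using (⊥-elim)
open import Function using (_∘_; flip)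
open import Relation.Nullary using (yes; no; contradiction)
open import Relation.Nullary.Decidable using (⌊_⌋)
open import Relation.Binary.PropositionalEquality using (_≡_; _≢_; _≗_; refl; sym; trans; cong; cong₂; subst; subst₂; module ≡-Reasoning)
open import Algebra.Properties.Semiring.Sum +-*-semiring using (sum-cong-≗; sum-replicate-zero; ∑-distrib-+; ∑-comm; *-distribˡ-sum) renaming (sum to ∑)

private variable
  n : ℕ
  A B : Set

-- Power series in x, y and z

-- Multiplication by one variable, read off at exponent m; the value 0 is the constant term of such
-- a product.
shift : ℕ → (ℕ → ℕ) → ℕ
shift zero    g = 0
shift (suc m) g = g m

shift-cong : ∀ m {g h : ℕ → ℕ} → (∀ k → g k ≡ h k) → shift m g ≡ shift m h
shift-cong zero    eq = refl
shift-cong (suc m) eq = eq m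

shift-+ : ∀ m (g h : ℕ → ℕ) → shift m (λ k → g k + h k) ≡ shift m g + shift m h
shift-+ zero    g h = refl
shift-+ (suc m) g h = refl

shift-swap : ∀ m k (g : ℕ → ℕ → ℕ) → shift m (λ m′ → shift k (g m′)) ≡ shift k (λ k′ → shift m (λ m′ → g m′ k′))
shift-swap zero    zero    g = refl
shift-swap zero    (suc k) g = refl
shift-swap (suc m) zero    g = refl
shift-swap (suc m) (suc k) g = refl

-- The coefficient of x^a y^b in (x+y)^(a+b), indexed by both exponents so that Pascal's rule holds
-- by definition.
binom : ℕ → ℕ → ℕ
binom zero    b       = 1
binom (suc a) zero    = 1
binom (suc a) (suc b) = binom a (suc b) + binom (suc a) b

binom-zeroʳ : ∀ a → binom a 0 ≡ 1
binom-zeroʳ zero    = refl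
binom-zeroʳ (suc a) = refl

-- `G r a b` is the coefficient of x^a y^b z^(-r).
Series : Set
Series = ℕ → ℕ → ℕ → ℕ

infix 4 _≈_
_≈_ : Series → Series → Set
G ≈ H = ∀ r a b → G r a b ≡ H r a b

infixl 6 _⊕_
_⊕_ : Series → Series → Series
(G ⊕ H) r a b = G r a b + H r a b

-- The index r counts powers of 1/z, so multiplication by z raises it. Terms with a positive power
-- of z are dropped; multiplying by x, y or z never leads back from them to r ≥ 0.
x· y· z· : Series → Series
x· G r a b = shift a (λ a′ → G r a′ b)
y· G r a b = shift b (G r a)
z· G r a b = G (suc r) a b

[y+z]· [x+z]· : Series → Series
[y+z]· G = y· G ⊕ z· G
[x+z]· G = x· G ⊕ z· G

-- The properties of multiplication by a fixed polynomial in x, y, z on which computations with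
-- `powers p q` rest.
record Multiplier (T : Series → Series) : Set where
  field
    resp-≈ : ∀ {G H} → G ≈ H → T G ≈ T H
    resp-⊕ : ∀ G H → T (G ⊕ H) ≈ T G ⊕ T H
    comm-x : ∀ G → T (x· G) ≈ x· (T G)
    comm-y : ∀ G → T (y· G) ≈ y· (T G)
    comm-z : ∀ G → T (z· G) ≈ z· (T G)

open Multiplier

x-multiplier : Multiplier x·
x-multiplier .resp-≈ eq r a b = shift-cong a (λ a′ → eq r a′ b)
x-multiplier .resp-⊕ G H r a b = shift-+ a _ _
x-multiplier .comm-x G r a b = refl
x-multiplier .comm-y G r a b = shift-swap a b (G r)
x-multiplier .comm-z G r a b = refl

y-multiplier : Multiplier y·
y-multiplier .resp-≈ eq r a b = shift-cong b (eq r a)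
y-multiplier .resp-⊕ G H r a b = shift-+ b _ _
y-multiplier .comm-x G r a b = sym (shift-swap a b (G r))
y-multiplier .comm-y G r a b = refl
y-multiplier .comm-z G r a b = refl

z-multiplier : Multiplier z·
z-multiplier .resp-≈ eq r a b = eq (suc r) a b
z-multiplier .resp-⊕ G H r a b = refl
z-multiplier .comm-x G r a b = refl
z-multiplier .comm-y G r a b = refl
z-multiplier .comm-z G r a b = refl

sum-multiplier : ∀ {S T} → Multiplier S → Multiplier T → Multiplier (λ G → S G ⊕ T G)
sum-multiplier s t .resp-≈ eq r a b = cong₂ _+_ (resp-≈ s eq r a b) (resp-≈ t eq r a b)
sum-multiplier {S} {T} s t .resp-⊕ G H r a b =
  trans (cong₂ _+_ (resp-⊕ s G H r a b) (resp-⊕ t G H r a b))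
        (interchange (S G r a b) (S H r a b) (T G r a b) (T H r a b))
  where
  interchange : ∀ k l m n → (k + l) + (m + n) ≡ (k + m) + (l + n)
  interchange = solve-∀
sum-multiplier {S} {T} s t .comm-x G r a b =
  trans (cong₂ _+_ (comm-x s G r a b) (comm-x t G r a b)) (sym (resp-⊕ x-multiplier (S G) (T G) r a b))
sum-multiplier {S} {T} s t .comm-y G r a b =
  trans (cong₂ _+_ (comm-y s G r a b) (comm-y t G r a b)) (sym (resp-⊕ y-multiplier (S G) (T G) r a b))
sum-multiplier s t .comm-z G r a b = cong₂ _+_ (comm-z s G r a b) (comm-z t G r a b)

id-multiplier : Multiplier (λ G → G)
id-multiplier .resp-≈ eq = eq
id-multiplier .resp-⊕ G H r a b = refl
id-multiplier .comm-x G r a b = refl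
id-multiplier .comm-y G r a b = refl
id-multiplier .comm-z G r a b = refl

comp-multiplier : ∀ {S T} → Multiplier S → Multiplier T → Multiplier (λ G → S (T G))
comp-multiplier s t .resp-≈ eq = resp-≈ s (resp-≈ t eq)
comp-multiplier s t .resp-⊕ G H r a b = trans (resp-≈ s (resp-⊕ t G H) r a b) (resp-⊕ s _ _ r a b)
comp-multiplier s t .comm-x G r a b = trans (resp-≈ s (comm-x t G) r a b) (comm-x s _ r a b)
comp-multiplier s t .comm-y G r a b = trans (resp-≈ s (comm-y t G) r a b) (comm-y s _ r a b)
comp-multiplier s t .comm-z G r a b = trans (resp-≈ s (comm-z t G) r a b) (comm-z s _ r a b)

[y+z]-multiplier : Multiplier [y+z]·
[y+z]-multiplier = sum-multiplier y-multiplier z-multiplier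

[x+z]-multiplier : Multiplier [x+z]·
[x+z]-multiplier = sum-multiplier x-multiplier z-multiplier

-- Multiplication by (y+z)^p (x+z)^q.
powers : ℕ → ℕ → Series → Series
powers zero    zero    G = G
powers zero    (suc q) G = [x+z]· (powers zero q G)
powers (suc p) q       G = [y+z]· (powers p q G)

powers-multiplier : ∀ p q → Multiplier (powers p q)
powers-multiplier zero    zero    = id-multiplier
powers-multiplier zero    (suc q) = comp-multiplier [x+z]-multiplier (powers-multiplier zero q)
powers-multiplier (suc p) q       = comp-multiplier [y+z]-multiplier (powers-multiplier p q)

-- The factors y+z stand outermost in `powers`, so a new factor x+z has to be commuted past them.
powers-sucʳ : ∀ p q G → powers p (suc q) G ≈ [x+z]· (powers p q G)
powers-sucʳ zero    q G r a b = refl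
powers-sucʳ (suc p) q G r a b =
  trans (resp-≈ [y+z]-multiplier (powers-sucʳ p q G) r a b)
 (trans (resp-⊕ [y+z]-multiplier (x· H) (z· H) r a b)
        (cong (_+ [y+z]· (z· H) r a b) (comm-x [y+z]-multiplier H r a b)))
  where H = powers p q G

-- ∑_{r,m} M r m (x+y)^m z^(-r)
merged : (ℕ → ℕ → ℕ) → Series
merged M r a b = binom a b * M r (a + b)

constant : (ℕ → ℕ) → Series
constant e r zero    zero    = e r
constant e r zero    (suc b) = 0
constant e r (suc a) b       = 0

-- Up to terms with r = 0 or m = 0, `merged M` is (x+y)/z times `merged (next M)`.
next : (ℕ → ℕ → ℕ) → (ℕ → ℕ → ℕ)
next M r m = M (suc r) (suc m)

-- Terms with m > 0 give up one factor x+y, by Pascal's rule; terms with m = 0 are free of x and y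
-- and form the constant.
z-merged : ∀ M → z· (merged M) ≈ (x· (merged (next M)) ⊕ y· (merged (next M))) ⊕ constant (λ r → M (suc r) 0)
z-merged M r zero    zero    = +-identityʳ _
z-merged M r zero    (suc b) = sym (+-identityʳ _)
z-merged M r (suc a) zero    rewrite binom-zeroʳ a = lemma (M (suc r) (suc (a + 0)))
  where
  lemma : ∀ k → k + 0 ≡ k + 0 + 0 + 0
  lemma = solve-∀
z-merged M r (suc a) (suc b) rewrite +-suc a b =
  lemma (binom a (suc b)) (binom (suc a) b) (M (suc r) (suc (suc (a + b))))
  where
  lemma : ∀ k l m → (k + l) * m ≡ k * m + l * m + 0
  lemma = solve-∀

-- (y+z)^p (x+z)^q has degree p + q, and the series it multiplies contains neither x nor y.
powers-constant-vanish : ∀ e p q r a b → p + q < a + b → powers p q (constant e) r a b ≡ 0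
powers-constant-vanish e zero    zero    r zero    (suc b) lt = refl
powers-constant-vanish e zero    zero    r (suc a) b       lt = refl
powers-constant-vanish e zero    (suc q) r zero    b       lt =
  powers-constant-vanish e 0 q (suc r) 0 b (<-trans (n<1+n q) lt)
powers-constant-vanish e zero    (suc q) r (suc a) b       lt =
  cong₂ _+_ (powers-constant-vanish e 0 q r a b (s≤s⁻¹ lt))
            (powers-constant-vanish e 0 q (suc r) (suc a) b (<-trans (n<1+n q) lt))
powers-constant-vanish e (suc p) q       r a       zero    lt =
  powers-constant-vanish e p q (suc r) a 0 (<-trans (n<1+n (p + q)) lt)
powers-constant-vanish e (suc p) q       r a       (suc b) lt =
  cong₂ _+_ (powers-constant-vanish e p q r a b (s≤s⁻¹ (subst (suc (p + q) <_) (+-suc a b) lt)))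
            (powers-constant-vanish e p q (suc r) a (suc b) (<-trans (n<1+n (p + q)) lt))

-- ∑_m c(p,q,m) M m m, in the notation above: comparing degrees, only z^(-r) with r = m can contribute.
diag : (ℕ → ℕ → ℕ) → ℕ → ℕ → ℕ
diag M p q = powers p q (merged M) 0 p q

-- At x^0 each of the q factors x+z must contribute z, which leads to the coefficient of z^(-q).
diag-zeroˡ : ∀ M q → diag M 0 q ≡ M q q
diag-zeroˡ M q = trans (go q 0 q) (trans (+-identityʳ _) (cong (λ k → M k q) (+-identityʳ q)))
  where
  go : ∀ k r b → powers 0 k (merged M) r 0 b ≡ merged M (k + r) 0 b
  go zero    r b = refl
  go (suc k) r b = trans (go k (suc r) b) (cong (λ l → merged M l 0 b) (+-suc k r))

diag-zeroʳ : ∀ M p → diag M p 0 ≡ M p p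
diag-zeroʳ M p = trans (go p 0 p) (trans (cong₂ (λ k l → k * M l (p + 0)) (binom-zeroʳ p) (+-identityʳ p))
                       (trans (+-identityʳ _) (cong (M p) (+-identityʳ p))))
  where
  go : ∀ k r a → powers k 0 (merged M) r a 0 ≡ merged M (k + r) a 0
  go zero    r a = refl
  go (suc k) r a = trans (go k (suc r) a) (cong (λ l → merged M l a 0) (+-suc k r))

-- The polynomial identity (y+z)(x+z)(x+y) = 2xyz + (x+y)xy + (x+z)xz + (y+z)yz, read off at x^(p+1) y^(q+1).
diag-suc-suc : ∀ M p q → diag M (suc p) (suc q) ≡
  diag M p q + (diag (next M) p (suc q) + diag (next M) (suc p) q + 2 * diag (next M) p q)
diag-suc-suc M p q = begin
  [y+z]· (powers p (suc q) (merged M)) 0 (suc p) (suc q)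
    ≡⟨ resp-≈ [y+z]-multiplier (powers-sucʳ p q (merged M)) 0 (suc p) (suc q) ⟩
  (H 0 p q + z· H 0 (suc p) q) + (z· H 0 p (suc q) + z· H 1 (suc p) (suc q))
    -- Of the four products of y or z with x or z, xy stays with `M`; in the other three, `zH`
    -- trades one z for x+y and `M` for `next M`.
    ≡⟨ cong₂ (λ k l → (H 0 p q + k) + l) (zH 0 (suc p) q ≤-refl)
        (cong₂ _+_ (zH 0 p (suc q) (≤-reflexive (sym (+-suc p q))))
                   (zH 1 (suc p) (suc q) (s≤s (≤-trans (n≤1+n _) (≤-reflexive (sym (+-suc p q))))))) ⟩
  (H 0 p q + (H⁺ 0 p q + y· H⁺ 0 (suc p) q)) + ((x· H⁺ 0 p (suc q) + H⁺ 0 p q) + (H⁺ 1 p (suc q) + H⁺ 1 (suc p) q))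
    ≡⟨ regroup (H 0 p q) (H⁺ 0 p q) (y· H⁺ 0 (suc p) q) (x· H⁺ 0 p (suc q)) (H⁺ 1 p (suc q)) (H⁺ 1 (suc p) q) ⟩
  H 0 p q + ([x+z]· H⁺ 0 p (suc q) + [y+z]· H⁺ 0 (suc p) q + 2 * H⁺ 0 p q)
    ≡⟨ cong (λ k → H 0 p q + (k + diag (next M) (suc p) q + 2 * H⁺ 0 p q)) (sym (powers-sucʳ p q (merged (next M)) 0 p (suc q))) ⟩
  diag M p q + (diag (next M) p (suc q) + diag (next M) (suc p) q + 2 * diag (next M) p q) ∎
  where
  open ≡-Reasoning
  T  = powers-multiplier p q
  H  = powers p q (merged M)
  H⁺ = powers p q (merged (next M))
  -- The constant left over from `z-merged` contributes nothing here, since a + b exceeds p + q.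
  zH : ∀ r a b → p + q < a + b → z· H r a b ≡ x· H⁺ r a b + y· H⁺ r a b
  zH r a b lt = begin
    z· H r a b                                   ≡⟨ sym (comm-z T (merged M) r a b) ⟩
    powers p q (z· (merged M)) r a b             ≡⟨ resp-≈ T (z-merged M) r a b ⟩
    powers p q ((x· G⁺ ⊕ y· G⁺) ⊕ E) r a b       ≡⟨ resp-⊕ T (x· G⁺ ⊕ y· G⁺) E r a b ⟩
    powers p q (x· G⁺ ⊕ y· G⁺) r a b + powers p q E r a b
      ≡⟨ cong₂ _+_ (resp-⊕ T (x· G⁺) (y· G⁺) r a b) (powers-constant-vanish _ p q r a b lt) ⟩
    powers p q (x· G⁺) r a b + powers p q (y· G⁺) r a b + 0
      ≡⟨ +-identityʳ _ ⟩
    powers p q (x· G⁺) r a b + powers p q (y· G⁺) r a b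
      ≡⟨ cong₂ _+_ (comm-x T G⁺ r a b) (comm-y T G⁺ r a b) ⟩
    x· H⁺ r a b + y· H⁺ r a b ∎
    where
    G⁺ = merged (next M)
    E  = constant (λ r → M (suc r) 0)
  regroup : ∀ h k l m n o → (h + (k + l)) + ((m + k) + (n + o)) ≡ h + ((m + n) + (l + o) + 2 * k)
  regroup = solve-∀

-- The boundary values and the recursion `diag-suc-suc` are both symmetric in p and q.
diag-sym : ∀ M p q → diag M p q ≡ diag M q p
diag-sym M zero    q       = trans (diag-zeroˡ M q) (sym (diag-zeroʳ M q))
diag-sym M (suc p) zero    = trans (diag-zeroʳ M (suc p)) (sym (diag-zeroˡ M (suc p)))
diag-sym M (suc p) (suc q) = begin
  diag M (suc p) (suc q)
    ≡⟨ diag-suc-suc M p q ⟩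
  diag M p q + (diag (next M) p (suc q) + diag (next M) (suc p) q + 2 * diag (next M) p q)
    ≡⟨ cong₂ _+_ (diag-sym M p q) (cong₂ _+_
        (trans (cong₂ _+_ (diag-sym (next M) p (suc q)) (diag-sym (next M) (suc p) q)) (+-comm (diag (next M) (suc q) p) _))
        (cong (2 *_) (diag-sym (next M) p q))) ⟩
  diag M q p + (diag (next M) q (suc p) + diag (next M) (suc q) p + 2 * diag (next M) q p)
    ≡⟨ sym (diag-suc-suc M q p) ⟩
  diag M (suc q) (suc p) ∎
  where open ≡-Reasoning

-- Expanding by `diag-suc-suc` gives four terms on each side: one is common, the others compare by
-- induction. For q = 0 < p the left side equals a single term of the right side.
diag-transfer : ∀ M p q → q ≤ p → diag M (suc p) q ≤ diag M p (suc q)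
diag-transfer M zero    zero    z≤n = ≤-reflexive (diag-sym M 1 0)
diag-transfer M (suc p) zero    z≤n = begin
  diag M (2 + p) 0                                             ≡⟨ diag-zeroʳ M (2 + p) ⟩
  next M (suc p) (suc p)                                       ≡⟨ sym (diag-zeroʳ (next M) (suc p)) ⟩
  diag (next M) (suc p) 0                                      ≤⟨ m≤n+m _ (diag (next M) p 1) ⟩
  diag (next M) p 1 + diag (next M) (suc p) 0                  ≤⟨ m≤m+n _ (2 * diag (next M) p 0) ⟩
  diag (next M) p 1 + diag (next M) (suc p) 0 + 2 * diag (next M) p 0 ≤⟨ m≤n+m _ (diag M p 0) ⟩
  diag M p 0 + (diag (next M) p 1 + diag (next M) (suc p) 0 + 2 * diag (next M) p 0) ≡⟨ sym (diag-suc-suc M p 0) ⟩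
  diag M (suc p) 1 ∎
  where open ≤-Reasoning
diag-transfer M (suc p) (suc q) (s≤s q≤p) = begin
  diag M (2 + p) (1 + q)
    ≡⟨ diag-suc-suc M (suc p) q ⟩
  diag M (1 + p) q + (diag M⁺ (1 + p) (1 + q) + diag M⁺ (2 + p) q + 2 * diag M⁺ (1 + p) q)
    ≤⟨ +-mono-≤ (diag-transfer M p q q≤p)
        (+-mono-≤ (+-monoʳ-≤ (diag M⁺ (1 + p) (1 + q)) (outer (m≤n⇒m<n∨m≡n q≤p)))
                  (*-monoʳ-≤ 2 (diag-transfer M⁺ p q q≤p))) ⟩
  diag M p (1 + q) + (diag M⁺ (1 + p) (1 + q) + diag M⁺ p (2 + q) + 2 * diag M⁺ p (1 + q))
    ≡⟨ cong (λ k → diag M p (1 + q) + (k + 2 * diag M⁺ p (1 + q))) (+-comm (diag M⁺ (1 + p) (1 + q)) _) ⟩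
  diag M p (1 + q) + (diag M⁺ p (2 + q) + diag M⁺ (1 + p) (1 + q) + 2 * diag M⁺ p (1 + q))
    ≡⟨ sym (diag-suc-suc M p (suc q)) ⟩
  diag M (1 + p) (2 + q) ∎
  where
  open ≤-Reasoning
  M⁺ = next M
  -- Two units are moved. If q = p, the second move would go from the smaller to the larger entry,
  -- but then the two sides are mirror images.
  outer : q < p ⊎ q ≡ p → diag M⁺ (2 + p) q ≤ diag M⁺ p (2 + q)
  outer (inj₁ q<p)  = ≤-trans (diag-transfer M⁺ (suc p) q (m≤n⇒m≤1+n q≤p)) (diag-transfer M⁺ p (suc q) q<p)
  outer (inj₂ refl) = ≤-reflexive (diag-sym M⁺ (2 + p) p)

-- Generating functions in one variable per letter

∑-zero : (φ : Fin n → ℕ) → (∀ l → φ l ≡ 0) → ∑ φ ≡ 0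
∑-zero {n} φ eq = trans (sum-cong-≗ eq) (sum-replicate-zero n)

-- Here `c` is the indicator of the indices other than j, as `others j` will be.
∑-split : ∀ j (c φ : Fin n → ℕ) → c j ≡ 0 → (∀ l → l ≢ j → c l ≡ 1) →
  ∑ φ ≡ φ j + ∑ (λ l → c l * φ l)
∑-split zero c φ c₀ c₁ rewrite c₀ =
  cong (φ zero +_) (sum-cong-≗ λ l → sym (trans (cong (_* φ (suc l)) (c₁ (suc l) λ ())) (+-identityʳ _)))
∑-split (suc j) c φ c₀ c₁ rewrite c₁ zero (λ ()) =
  trans (cong (φ zero +_) (∑-split j (c ∘ suc) (φ ∘ suc) c₀ (λ l l≢j → c₁ (suc l) (l≢j ∘ Fin.suc-injective))))
        (lemma (φ zero) (φ (suc j)) (∑ (λ l → c (suc l) * φ (suc l))))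
  where
  lemma : ∀ a b c → a + (b + c) ≡ b + (a + 0 + c)
  lemma = solve-∀

-- `X l` multiplies a generating function, given by its coefficients, with the variable x_l.
X : Fin n → (Vec ℕ n → ℕ) → Vec ℕ n → ℕ
X l f t = shift (lookup t l) (λ m → f (t [ l ]≔ m))

X-cong : ∀ l {f g : Vec ℕ n → ℕ} → f ≗ g → X l f ≗ X l g
X-cong l eq t = shift-cong (lookup t l) (λ m → eq _)

X-+ : ∀ l (f g : Vec ℕ n → ℕ) t → X l (λ t → f t + g t) t ≡ X l f t + X l g t
X-+ l f g t = shift-+ (lookup t l) _ _

X-* : ∀ l c (f : Vec ℕ n → ℕ) t → X l (λ t → c * f t) t ≡ c * X l f t
X-* l c f t with lookup t l
... | zero  = sym (*-zeroʳ c)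
... | suc m = refl

X-comm : ∀ l k (f : Vec ℕ n → ℕ) t → X l (X k f) t ≡ X k (X l f) t
X-comm l k f t with l ≟ k
... | yes refl = refl
... | no l≢k = begin
  shift (lookup t l) (λ m → shift (lookup (t [ l ]≔ m) k) (λ m′ → f ((t [ l ]≔ m) [ k ]≔ m′)))
    ≡⟨ shift-cong (lookup t l) (λ m → cong (λ z → shift z (λ m′ → f ((t [ l ]≔ m) [ k ]≔ m′))) (lookup∘update′ (l≢k ∘ sym) t m)) ⟩
  shift (lookup t l) (λ m → shift (lookup t k) (λ m′ → f ((t [ l ]≔ m) [ k ]≔ m′)))
    ≡⟨ shift-swap (lookup t l) (lookup t k) _ ⟩
  shift (lookup t k) (λ m′ → shift (lookup t l) (λ m → f ((t [ l ]≔ m) [ k ]≔ m′)))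
    ≡⟨ shift-cong (lookup t k) (λ m′ → shift-cong (lookup t l) (λ m → cong f ([]≔-commutes t l k l≢k))) ⟩
  shift (lookup t k) (λ m′ → shift (lookup t l) (λ m → f ((t [ k ]≔ m′) [ l ]≔ m)))
    ≡⟨ shift-cong (lookup t k) (λ m′ → cong (λ z → shift z (λ m → f ((t [ k ]≔ m′) [ l ]≔ m))) (sym (lookup∘update′ l≢k t m′))) ⟩
  shift (lookup t k) (λ m′ → shift (lookup (t [ k ]≔ m′) l) (λ m → f ((t [ k ]≔ m′) [ l ]≔ m))) ∎
  where open ≡-Reasoning

-- Multiplication by linear forms

linearForm : (Fin n → ℕ) → (Vec ℕ n → ℕ) → Vec ℕ n → ℕ
linearForm v f t = ∑ (λ l → v l * X l f t)

linearForm-congˡ : ∀ {v v′} (f : Vec ℕ n → ℕ) → v ≗ v′ → linearForm v f ≗ linearForm v′ f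
linearForm-congˡ f eq t = sum-cong-≗ (λ l → cong (_* X l f t) (eq l))

linearForm-congʳ : ∀ v {f g : Vec ℕ n → ℕ} → f ≗ g → linearForm v f ≗ linearForm v g
linearForm-congʳ v eq t = sum-cong-≗ (λ l → cong (v l *_) (X-cong l eq t))

linearForm-+ : ∀ v (f g : Vec ℕ n → ℕ) t → linearForm v (λ t → f t + g t) t ≡ linearForm v f t + linearForm v g t
linearForm-+ v f g t =
  trans (sum-cong-≗ (λ l → trans (cong (v l *_) (X-+ l f g t)) (*-distribˡ-+ (v l) (X l f t) (X l g t))))
        (∑-distrib-+ (λ l → v l * X l f t) (λ l → v l * X l g t))

linearForm-* : ∀ v c (f : Vec ℕ n → ℕ) t → linearForm v (λ t → c * f t) t ≡ c * linearForm v f t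
linearForm-* v c f t =
  trans (sum-cong-≗ (λ l → trans (cong (v l *_) (X-* l c f t)) (lemma (v l) c (X l f t))))
        (sym (*-distribˡ-sum c (λ l → v l * X l f t)))
  where
  lemma : ∀ a b c → a * (b * c) ≡ b * (a * c)
  lemma = solve-∀

X-linearForm : ∀ l v (f : Vec ℕ n → ℕ) t → X l (linearForm v f) t ≡ ∑ (λ k → v k * X l (X k f) t)
X-linearForm l v f t with lookup t l
... | zero  = sym (∑-zero _ (λ k → *-zeroʳ (v k)))
... | suc m = refl

linearForm-X : ∀ l v (f : Vec ℕ n → ℕ) t → linearForm v (X l f) t ≡ X l (linearForm v f) t
linearForm-X l v f t =
  trans (sum-cong-≗ (λ k → cong (v k *_) (X-comm k l f t))) (sym (X-linearForm l v f t))

-- Lets the letters of a word be permuted in `coefficient`; the double sum is symmetric because the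
-- operators `X l` commute.
linearForm-comm : ∀ v v′ (f : Vec ℕ n → ℕ) → linearForm v (linearForm v′ f) ≗ linearForm v′ (linearForm v f)
linearForm-comm {n} v v′ f t = begin
  ∑ (λ l → v l * X l (linearForm v′ f) t)
    ≡⟨ sum-cong-≗ (λ l → trans (cong (v l *_) (X-linearForm l v′ f t)) (*-distribˡ-sum (v l) (λ k → v′ k * X l (X k f) t))) ⟩
  ∑ (λ l → ∑ (λ k → v l * (v′ k * X l (X k f) t)))
    ≡⟨ ∑-comm {n} {n} _ ⟩
  ∑ (λ k → ∑ (λ l → v l * (v′ k * X l (X k f) t)))
    ≡⟨ sum-cong-≗ (λ k → sum-cong-≗ (λ l →
         trans (cong (λ z → v l * (v′ k * z)) (X-comm l k f t)) (lemma (v l) (v′ k) _))) ⟩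
  ∑ (λ k → ∑ (λ l → v′ k * (v l * X k (X l f) t)))
    ≡⟨ sum-cong-≗ (λ k → sym (trans (cong (v′ k *_) (X-linearForm k v f t)) (*-distribˡ-sum (v′ k) (λ l → v l * X k (X l f) t)))) ⟩
  ∑ (λ k → v′ k * X k (linearForm v f) t) ∎
  where
  open ≡-Reasoning
  lemma : ∀ a b c → a * (b * c) ≡ b * (a * c)
  lemma = solve-∀

-- The coefficients of the linear form S - x_k.
others : Fin n → Fin n → ℕ
others k l = if ⌊ l ≟ k ⌋ then 0 else 1

others-same : (k : Fin n) → others k k ≡ 0
others-same k with k ≟ k
... | yes _  = refl
... | no k≢k = contradiction refl k≢k

others-diff : (k l : Fin n) → l ≢ k → others k l ≡ 1
others-diff k l l≢k with l ≟ k
... | yes l≡k = contradiction l≡k l≢k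
... | no _    = refl

others-idem : (k l : Fin n) → others k l * others k l ≡ others k l
others-idem k l with l ≟ k
... | yes _ = refl
... | no _  = refl

-- Counting words

allTests : Vec ℕ n → List (Fin n) → List (Fin n) → Bool
allTests t u []       = true
allTests t u (i ∷ is) = (count i u ≡ᵇ lookup t i) ∧ allTests t u is

mutual
  -- The local function of `isRearrangement` has no name; unification in `isRearrangement-unfold` recovers it.
  hiddenTests : Vec ℕ n → List (Fin n) → List (Fin n) → Bool
  hiddenTests = _

  isRearrangement-unfold : (t : Vec ℕ n) (u : List (Fin n)) → isRearrangement t u ≡ hiddenTests t u (allFin n)
  -- Abstracting the list to a variable lets unification determine `hiddenTests` on all lists.
  isRearrangement-unfold {n} t u with allFin n
  ... | is = refl

isRearrangement≡allTests : (t : Vec ℕ n) (u : List (Fin n)) → isRearrangement t u ≡ allTests t u (allFin n)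
isRearrangement≡allTests {n} t u = trans (isRearrangement-unfold t u) (go (allFin n))
  where
  go : ∀ is → hiddenTests t u is ≡ allTests t u is
  go []       = refl
  go (i ∷ is) = cong (_ ∧_) (go is)

allTests-cong : (t t′ : Vec ℕ n) (u u′ : List (Fin n)) →
  (∀ i → (count i u ≡ᵇ lookup t i) ≡ (count i u′ ≡ᵇ lookup t′ i)) → ∀ is → allTests t u is ≡ allTests t′ u′ is
allTests-cong t t′ u u′ eq []       = refl
allTests-cong t t′ u u′ eq (i ∷ is) = cong₂ _∧_ (eq i) (allTests-cong t t′ u u′ eq is)

allTests-false : (t : Vec ℕ n) (u : List (Fin n)) {l : Fin n} → (count l u ≡ᵇ lookup t l) ≡ false →
  ∀ {is} → l ∈ is → allTests t u is ≡ false
allTests-false t u eq {i ∷ is} (here refl) = cong (_∧ allTests t u is) eq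
allTests-false t u eq (there {x = i} l∈) =
  trans (cong ((count i u ≡ᵇ lookup t i) ∧_) (allTests-false t u eq l∈)) (∧-zeroʳ _)

isRearrangement-false : (t : Vec ℕ n) (u : List (Fin n)) (l : Fin n) → (count l u ≡ᵇ lookup t l) ≡ false →
  isRearrangement t u ≡ false
isRearrangement-false t u l eq = trans (isRearrangement≡allTests t u) (allTests-false t u eq (∈-allFin l))

count-same : (l : Fin n) (u : List (Fin n)) → count l (l ∷ u) ≡ suc (count l u)
count-same l u with l ≟ l
... | yes _  = refl
... | no l≢l = contradiction refl l≢l

isRearrangement-∷-zero : (t : Vec ℕ n) (l : Fin n) (u : List (Fin n)) → lookup t l ≡ 0 → isRearrangement t (l ∷ u) ≡ false
isRearrangement-∷-zero t l u eq = isRearrangement-false t (l ∷ u) l (cong₂ _≡ᵇ_ (count-same l u) eq)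

isRearrangement-∷-suc : (t : Vec ℕ n) (l : Fin n) (u : List (Fin n)) {m : ℕ} → lookup t l ≡ suc m →
  isRearrangement t (l ∷ u) ≡ isRearrangement (t [ l ]≔ m) u
isRearrangement-∷-suc {n} t l u {m} eq =
  trans (isRearrangement≡allTests t (l ∷ u))
 (trans (allTests-cong t (t [ l ]≔ m) (l ∷ u) u test (allFin n))
        (sym (isRearrangement≡allTests (t [ l ]≔ m) u)))
  where
  test : ∀ i → (count i (l ∷ u) ≡ᵇ lookup t i) ≡ (count i u ≡ᵇ lookup (t [ l ]≔ m) i)
  test i with l ≟ i
  ... | yes refl = trans (cong (suc (count l u) ≡ᵇ_) eq) (cong (count l u ≡ᵇ_) (sym (lookup∘update l t m)))
  ... | no l≢i     = cong (count i u ≡ᵇ_) (sym (lookup∘update′ (l≢i ∘ sym) t m))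

-- Counting by a Boolean test

number : (A → Bool) → List A → ℕ
number p xs = length (filterᵇ p xs)

number-cong : {p q : A → Bool} → p ≗ q → ∀ xs → number p xs ≡ number q xs
number-cong eq [] = refl
number-cong {q = q} eq (x ∷ xs) rewrite eq x with q x
... | true  = cong suc (number-cong eq xs)
... | false = number-cong eq xs

number-false : (xs : List A) → number (λ _ → false) xs ≡ 0
number-false []       = refl
number-false (x ∷ xs) = number-false xs

number-++ : ∀ (p : A → Bool) xs ys → number p (xs ++ ys) ≡ number p xs + number p ys
number-++ p [] ys = refl
number-++ p (x ∷ xs) ys with p x
... | true  = cong suc (number-++ p xs ys)
... | false = number-++ p xs ys

number-map : ∀ p (g : B → A) xs → number p (map g xs) ≡ number (p ∘ g) xs
number-map p g [] = refl
number-map p g (x ∷ xs) with p (g x)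
... | true  = cong suc (number-map p g xs)
... | false = number-map p g xs

number-concatMap-tabulate : ∀ p (g : B → List A) (f : Fin n → B) →
  number p (concatMap g (tabulate f)) ≡ ∑ (λ l → number p (g (f l)))
number-concatMap-tabulate {n = zero}  p g f = refl
number-concatMap-tabulate {n = suc n} p g f =
  trans (number-++ p (g (f zero)) _) (cong (number p (g (f zero)) +_) (number-concatMap-tabulate p g (f ∘ suc)))

-- `coefficient w t` is the coefficient of x^t in the product over k in w of the sums of all x_l with l ≠ k.
coefficient : List (Fin n) → Vec ℕ n → ℕ
coefficient []      t = if isRearrangement t [] then 1 else 0
coefficient (k ∷ w) = linearForm (others k) (coefficient w)

-- Sort the words u by their first letter l: l ≠ k gives the weight `others k l`, and the rest of u
-- is counted with t_l lowered by one, which is multiplication by x_l.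
number≡coefficient : (w : List (Fin n)) (t : Vec ℕ n) →
  number (λ u → isRearrangement t u ∧ noFixed u w) (allWords n (length w)) ≡ coefficient w t
number≡coefficient [] t with isRearrangement t []
... | true  = refl
... | false = refl
number≡coefficient {n} (k ∷ w) t =
  trans (number-concatMap-tabulate good (λ l → map (l ∷_) words) (λ l → l))
        (sum-cong-≗ (λ l → trans (number-map good (l ∷_) words) (step l)))
  where
  words = allWords n (length w)
  good  = λ u → isRearrangement t u ∧ noFixed u (k ∷ w)
  step : ∀ l → number (λ u → good (l ∷ u)) words ≡ others k l * X l (coefficient w) t
  step l with l ≟ k
  ... | yes _ = trans (number-cong (λ u → ∧-zeroʳ (isRearrangement t (l ∷ u))) words) (number-false words)
  ... | no _ with lookup t l in eq
  ...   | zero  = trans (number-cong (λ u → cong (_∧ noFixed u w) (isRearrangement-∷-zero t l u eq)) words) (number-false words)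
  ...   | suc m = trans (number-cong (λ u → cong (_∧ noFixed u w) (isRearrangement-∷-suc t l u eq)) words)
                 (trans (number≡coefficient w (t [ l ]≔ m)) (sym (+-identityʳ _)))

P′≡coefficient : (t : Vec ℕ n) → P′ t ≡ coefficient (baseWord t) t
P′≡coefficient t = number≡coefficient (baseWord t) t

coefficient-↭ : {w w′ : List (Fin n)} → w ↭ w′ → coefficient w ≗ coefficient w′
coefficient-↭ _↭_.refl         t = refl
coefficient-↭ (prep k p)   t = linearForm-congʳ (others k) (coefficient-↭ p) t
coefficient-↭ (swap {ys = w} k l p) t =
  trans (linearForm-congʳ (others k) (linearForm-congʳ (others l) (coefficient-↭ p)) t)
        (linearForm-comm (others k) (others l) (coefficient w) t)
coefficient-↭ (_↭_.trans p q)  t = trans (coefficient-↭ p t) (coefficient-↭ q t)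

-- Base words up to permutation

baseWord-∷ : ∀ m (t : Vec ℕ n) → baseWord (m ∷ t) ≡ replicate m zero ++ map suc (baseWord t)
baseWord-∷ {n} m t = cong (replicate m zero ++_) (begin
  concatMap (λ i → replicate (lookup (m ∷ t) i) i) (tabulate suc)
    ≡⟨ cong (concatMap λ i → replicate (lookup (m ∷ t) i) i) (sym (map-tabulate {n = n} (λ i → i) suc)) ⟩
  concatMap (λ i → replicate (lookup (m ∷ t) i) i) (map suc (allFin n))
    ≡⟨ concatMap-map _ suc (allFin n) ⟩
  concatMap (λ i → replicate (lookup t i) (suc i)) (allFin n)
    ≡⟨ concatMap-cong (λ i → sym (map-replicate suc (lookup t i) i)) (allFin n) ⟩
  concatMap (λ i → map suc (replicate (lookup t i) i)) (allFin n)
    ≡⟨ sym (map-concatMap suc _ (allFin n)) ⟩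
  map suc (baseWord t) ∎)
  where open ≡-Reasoning

baseWord-suc : ∀ (t : Vec ℕ n) i m → baseWord (t [ i ]≔ suc m) ↭ i ∷ baseWord (t [ i ]≔ m)
baseWord-suc (k ∷ t) zero m
  rewrite baseWord-∷ (suc m) t | baseWord-∷ m t = ↭-refl
baseWord-suc (k ∷ t) (suc i) m
  rewrite baseWord-∷ k (t [ i ]≔ suc m) | baseWord-∷ k (t [ i ]≔ m) =
  ↭-trans (++⁺ˡ (replicate k zero) (map⁺ suc (baseWord-suc t i m))) (↭-shift (suc i) (replicate k zero) _)

baseWord-replicate : ∀ (t : Vec ℕ n) i m → baseWord (t [ i ]≔ m) ↭ replicate m i ++ baseWord (t [ i ]≔ 0)
baseWord-replicate t i zero    = ↭-refl
baseWord-replicate t i (suc m) = ↭-trans (baseWord-suc t i m) (prep i (baseWord-replicate t i m))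

baseWord-avoids : ∀ (t : Vec ℕ n) i → lookup t i ≡ 0 → All (_≢ i) (baseWord t)
baseWord-avoids {n} t i eq = All.concat⁺ (All.map⁺ (All.universal avoids (allFin n)))
  where
  avoids : ∀ k → All (_≢ i) (replicate (lookup t k) k)
  avoids k with k ≟ i
  ... | yes refl rewrite eq = []
  ... | no k≢i     = All.replicate⁺ (lookup t k) k≢i

-- Isolating two letters

module Pair {n} (i j : Fin n) (i≢j : i ≢ j) where

  at : Vec ℕ n → ℕ → ℕ → Vec ℕ n
  at s a b = (s [ i ]≔ a) [ j ]≔ b

  X-at-i : ∀ f s a b → X i f (at s a b) ≡ shift a (λ a′ → f (at s a′ b))
  X-at-i f s a b = trans
    (cong (λ z → shift z (λ m → f (at s a b [ i ]≔ m)))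
      (trans (lookup∘update′ i≢j (s [ i ]≔ a) b) (lookup∘update i s a)))
    (shift-cong a (λ a′ → cong f (trans ([]≔-commutes (s [ i ]≔ a) j i (i≢j ∘ sym)) (cong (_[ j ]≔ b) ([]≔-idempotent s i)))))

  X-at-j : ∀ f s a b → X j f (at s a b) ≡ shift b (λ b′ → f (at s a b′))
  X-at-j f s a b = trans
    (cong (λ z → shift z (λ m → f (at s a b [ j ]≔ m))) (lookup∘update j (s [ i ]≔ a) b))
    (shift-cong b (λ b′ → cong f ([]≔-idempotent (s [ i ]≔ a) j)))

  X-at-other : ∀ l → l ≢ i → l ≢ j → ∀ f s a b → X l f (at s a b) ≡ X l (λ s → f (at s a b)) s
  X-at-other l l≢i l≢j f s a b = trans
    (cong (λ z → shift z (λ m → f (at s a b [ l ]≔ m)))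
      (trans (lookup∘update′ l≢j (s [ i ]≔ a) b) (lookup∘update′ l≢i s a)))
    (shift-cong (lookup s l) (λ m → cong f (trans ([]≔-commutes (s [ i ]≔ a) j l (l≢j ∘ sym))
      (cong (_[ j ]≔ b) ([]≔-commutes s i l (l≢i ∘ sym))))))

  -- A form free of x_i and x_j leaves their exponents alone, so it can act with a and b frozen.
  linearForm-at : ∀ c → c i ≡ 0 → c j ≡ 0 → ∀ f s a b →
    linearForm c f (at s a b) ≡ linearForm c (λ s → f (at s a b)) s
  linearForm-at c cᵢ cⱼ f s a b = sum-cong-≗ term
    where
    term : ∀ l → c l * X l f (at s a b) ≡ c l * X l (λ s → f (at s a b)) s
    term l with l ≟ i | l ≟ j
    ... | yes refl | _          rewrite cᵢ = refl
    ... | no _       | yes refl rewrite cⱼ = refl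
    ... | no l≢i     | no l≢j     = cong (c l *_) (X-at-other l l≢i l≢j f s a b)

  -- The coefficients of z, the sum of all variables other than x_i and x_j.
  rest : Fin n → ℕ
  rest l = others j l * others i l

  restᵢ : rest i ≡ 0
  restᵢ = trans (cong (others j i *_) (others-same i)) (*-zeroʳ (others j i))

  restⱼ : rest j ≡ 0
  restⱼ = cong (_* others i j) (others-same j)

  linearForm-split : ∀ v f t →
    linearForm v f t ≡ v i * X i f t + (v j * X j f t + linearForm (λ l → rest l * v l) f t)
  linearForm-split v f t = begin
    ∑ φ
      ≡⟨ ∑-split i (others i) φ (others-same i) (others-diff i) ⟩
    φ i + ∑ (λ l → others i l * φ l)
      ≡⟨ cong (φ i +_) (∑-split j (others j) _ (others-same j) (others-diff j)) ⟩
    φ i + (others i j * φ j + ∑ (λ l → others j l * (others i l * φ l)))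
      ≡⟨ cong (φ i +_) (cong₂ _+_
           (trans (cong (_* φ j) (others-diff i j (i≢j ∘ sym))) (+-identityʳ (φ j)))
           (sum-cong-≗ (λ l → lemma (others j l) (others i l) (v l) (X l f t)))) ⟩
    φ i + (φ j + ∑ (λ l → rest l * v l * X l f t)) ∎
    where
    open ≡-Reasoning
    φ = λ l → v l * X l f t
    lemma : ∀ a b c d → a * (b * (c * d)) ≡ a * b * c * d
    lemma = solve-∀

  R : (Vec ℕ n → ℕ) → Vec ℕ n → ℕ
  R = linearForm rest

  -- S - x_i = x_j + z, the factor y+z.
  others-i : ∀ f t → linearForm (others i) f t ≡ X j f t + R f t
  others-i f t
    rewrite linearForm-split (others i) f t | others-same i | others-diff i j (i≢j ∘ sym) =
    cong₂ _+_ (+-identityʳ _) (linearForm-congˡ f (λ l →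
      trans (*-assoc (others j l) (others i l) (others i l)) (cong (others j l *_) (others-idem i l))) t)

  others-j : ∀ f t → linearForm (others j) f t ≡ X i f t + R f t
  others-j f t
    rewrite linearForm-split (others j) f t | others-same j | others-diff j i i≢j =
    cong₂ _+_ (+-identityʳ _) (linearForm-congˡ f (λ l →
      trans (lemma (others j l) (others i l)) (cong (_* others i l) (others-idem j l))) t)
    where
    lemma : ∀ a b → a * b * a ≡ a * a * b
    lemma = solve-∀

  others-else : ∀ k → k ≢ i → k ≢ j → ∀ f t →
    linearForm (others k) f t ≡ X i f t + (X j f t + linearForm (λ l → rest l * others k l) f t)
  others-else k k≢i k≢j f t
    rewrite linearForm-split (others k) f t | others-diff k i (k≢i ∘ sym) | others-diff k j (k≢j ∘ sym) =
    cong₂ _+_ (+-identityʳ (X i f t))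
      (cong (_+ linearForm (λ l → rest l * others k l) f t) (+-identityʳ (X j f t)))

  -- f depends on x_i and x_j only through x_i + x_j.
  Merged : (Vec ℕ n → ℕ) → Set
  Merged f = ∀ s a b → f (at s a b) ≡ binom a b * f (at s 0 (a + b))

  linearForm-Merged : ∀ {f} c → c i ≡ 0 → c j ≡ 0 → Merged f → Merged (linearForm c f)
  linearForm-Merged {f} c cᵢ cⱼ m s a b = begin
    linearForm c f (at s a b)                                  ≡⟨ linearForm-at c cᵢ cⱼ f s a b ⟩
    linearForm c (λ s → f (at s a b)) s                        ≡⟨ linearForm-congʳ c (λ s → m s a b) s ⟩
    linearForm c (λ s → binom a b * f (at s 0 (a + b))) s      ≡⟨ linearForm-* c (binom a b) (λ s → f (at s 0 (a + b))) s ⟩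
    binom a b * linearForm c (λ s → f (at s 0 (a + b))) s      ≡⟨ cong (binom a b *_) (sym (linearForm-at c cᵢ cⱼ f s 0 (a + b))) ⟩
    binom a b * linearForm c f (at s 0 (a + b))                ∎
    where open ≡-Reasoning

  -- The form S - x_k is x_i + x_j plus a form free of both; Pascal's rule handles the factor x_i +
  -- x_j.
  others-Merged : ∀ {f} k → k ≢ i → k ≢ j → Merged f → Merged (linearForm (others k) f)
  others-Merged {f} k k≢i k≢j m s a b = begin
    linearForm (others k) f (at s a b)
      ≡⟨ unfold a b ⟩
    shift a (λ a′ → f (at s a′ b)) + (shift b (λ b′ → f (at s a b′)) + E (at s a b))
      ≡⟨ cong (λ z → shift a (λ a′ → f (at s a′ b)) + (shift b (λ b′ → f (at s a b′)) + z)) (E-Merged s a b) ⟩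
    shift a (λ a′ → f (at s a′ b)) + (shift b (λ b′ → f (at s a b′)) + binom a b * E (at s 0 (a + b)))
      ≡⟨ pascal a b ⟩
    binom a b * (shift (a + b) (λ b′ → f (at s 0 b′)) + E (at s 0 (a + b)))
      ≡⟨ cong (binom a b *_) (sym (unfold 0 (a + b))) ⟩
    binom a b * linearForm (others k) f (at s 0 (a + b)) ∎
    where
    open ≡-Reasoning
    E = linearForm (λ l → rest l * others k l) f
    E-Merged : Merged E
    E-Merged = linearForm-Merged {f} (λ l → rest l * others k l) (cong (_* others k i) restᵢ) (cong (_* others k j) restⱼ) m
    unfold : ∀ a b → linearForm (others k) f (at s a b) ≡
      shift a (λ a′ → f (at s a′ b)) + (shift b (λ b′ → f (at s a b′)) + E (at s a b))
    unfold a b = trans (others-else k k≢i k≢j f (at s a b))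
      (cong₂ _+_ (X-at-i f s a b) (cong (_+ E (at s a b)) (X-at-j f s a b)))
    pascal : ∀ a b →
      shift a (λ a′ → f (at s a′ b)) + (shift b (λ b′ → f (at s a b′)) + binom a b * E (at s 0 (a + b))) ≡
      binom a b * (shift (a + b) (λ b′ → f (at s 0 b′)) + E (at s 0 (a + b)))
    pascal zero    b       = lemma (shift b (λ b′ → f (at s 0 b′))) (E (at s 0 b))
      where
      lemma : ∀ x y → x + 1 * y ≡ 1 * (x + y)
      lemma = solve-∀
    pascal (suc a) zero    = trans (cong (_+ (0 + 1 * e)) (trans (m s a 0) (cong (_* g) (binom-zeroʳ a)))) (lemma g e)
      where
      g = f (at s 0 (a + 0))
      e = E (at s 0 (suc a + 0))
      lemma : ∀ x y → 1 * x + (0 + 1 * y) ≡ 1 * (x + y)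
      lemma = solve-∀
    pascal (suc a) (suc b) = trans
      (cong₂ (λ x y → x + (y + binom (suc a) (suc b) * e)) (m s a (suc b))
        (trans (m s (suc a) b) (cong (λ z → binom (suc a) b * f (at s 0 z)) (sym (+-suc a b)))))
      (lemma (binom a (suc b)) (binom (suc a) b) (f (at s 0 (a + suc b))) e)
      where
      e = E (at s 0 (suc a + suc b))
      lemma : ∀ k l x y → k * x + (l * x + (k + l) * y) ≡ (k + l) * (x + y)
      lemma = solve-∀

  -- The series is the constant 1, so for a > 0 both sides vanish, at positive exponents of x_i and
  -- x_j respectively.
  empty-Merged : Merged (coefficient [])
  empty-Merged s zero    b = sym (+-identityʳ _)
  empty-Merged s (suc a) b = trans
    (vanish (at s (suc a) b) i (trans (lookup∘update′ i≢j (s [ i ]≔ suc a) b) (lookup∘update i s (suc a))))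
    (sym (trans (cong (binom (suc a) b *_) (vanish (at s 0 (suc a + b)) j (lookup∘update j (s [ i ]≔ 0) (suc a + b))))
      (*-zeroʳ (binom (suc a) b))))
    where
    vanish : ∀ t l {m} → lookup t l ≡ suc m → coefficient [] t ≡ 0
    vanish t l eq = cong (if_then 1 else 0) (isRearrangement-false t [] l (cong (0 ≡ᵇ_) eq))

  coefficient-Merged : ∀ {w} → All (_≢ i) w → All (_≢ j) w → Merged (coefficient w)
  coefficient-Merged []           []           = empty-Merged
  coefficient-Merged {k ∷ w} (k≢i ∷ ws≢i) (k≢j ∷ ws≢j) = others-Merged {coefficient w} k k≢i k≢j (coefficient-Merged ws≢i ws≢j)

  -- `R` is applied first, so that raising r by one in `series`, as `z·` does, is by definition
  -- replacing f by `R f`.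
  R^ : ℕ → (Vec ℕ n → ℕ) → Vec ℕ n → ℕ
  R^ zero    f = f
  R^ (suc r) f = R^ r (R f)

  R^-cong : ∀ r {f g} → f ≗ g → R^ r f ≗ R^ r g
  R^-cong zero    eq = eq
  R^-cong (suc r) eq = R^-cong r (linearForm-congʳ rest eq)

  R^-+ : ∀ r f g t → R^ r (λ t → f t + g t) t ≡ R^ r f t + R^ r g t
  R^-+ zero    f g t = refl
  R^-+ (suc r) f g t = trans (R^-cong r (linearForm-+ rest f g) t) (R^-+ r (R f) (R g) t)

  R^-X : ∀ r l f t → R^ r (X l f) t ≡ X l (R^ r f) t
  R^-X zero    l f t = refl
  R^-X (suc r) l f t = trans (R^-cong r (linearForm-X l rest f) t) (R^-X r l (R f) t)

  R^-Merged : ∀ r {f} → Merged f → Merged (R^ r f)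
  R^-Merged zero    m = m
  R^-Merged (suc r) {f} m = R^-Merged r (linearForm-Merged {f} rest restᵢ restⱼ m)

  -- Storing z^r f at z^(-r) makes the formal variable z act as the sum of the other variables, the
  -- exponents of which are fixed by s.
  series : Vec ℕ n → (Vec ℕ n → ℕ) → Series
  series s f r a b = R^ r f (at s a b)

  series-others-i : ∀ s f → series s (linearForm (others i) f) ≈ [y+z]· (series s f)
  series-others-i s f r a b = begin
    R^ r (linearForm (others i) f) (at s a b)               ≡⟨ R^-cong r (others-i f) (at s a b) ⟩
    R^ r (λ t → X j f t + R f t) (at s a b)                 ≡⟨ R^-+ r (X j f) (R f) (at s a b) ⟩
    R^ r (X j f) (at s a b) + R^ r (R f) (at s a b)         ≡⟨ cong (_+ R^ r (R f) (at s a b)) (R^-X r j f (at s a b)) ⟩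
    X j (R^ r f) (at s a b) + R^ r (R f) (at s a b)         ≡⟨ cong (_+ R^ r (R f) (at s a b)) (X-at-j (R^ r f) s a b) ⟩
    [y+z]· (series s f) r a b                               ∎
    where open ≡-Reasoning

  series-others-j : ∀ s f → series s (linearForm (others j) f) ≈ [x+z]· (series s f)
  series-others-j s f r a b = begin
    R^ r (linearForm (others j) f) (at s a b)               ≡⟨ R^-cong r (others-j f) (at s a b) ⟩
    R^ r (λ t → X i f t + R f t) (at s a b)                 ≡⟨ R^-+ r (X i f) (R f) (at s a b) ⟩
    R^ r (X i f) (at s a b) + R^ r (R f) (at s a b)         ≡⟨ cong (_+ R^ r (R f) (at s a b)) (R^-X r i f (at s a b)) ⟩
    X i (R^ r f) (at s a b) + R^ r (R f) (at s a b)         ≡⟨ cong (_+ R^ r (R f) (at s a b)) (X-at-i (R^ r f) s a b) ⟩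
    [x+z]· (series s f) r a b                               ∎
    where open ≡-Reasoning

  series-word : ∀ s w p q →
    series s (coefficient (replicate p i ++ replicate q j ++ w)) ≈ powers p q (series s (coefficient w))
  series-word s w zero    zero    r a b = refl
  series-word s w zero    (suc q) r a b =
    trans (series-others-j s _ r a b) (resp-≈ [x+z]-multiplier (series-word s w zero q) r a b)
  series-word s w (suc p) q       r a b =
    trans (series-others-i s _ r a b) (resp-≈ [y+z]-multiplier (series-word s w p q) r a b)

  -- The weight of (x+y)^m z^(-r), read off at x^0 y^m; it depends on neither p nor q.
  weights : Vec ℕ n → ℕ → ℕ → ℕ
  weights s r m = R^ r (coefficient (baseWord (at s 0 0))) (at s 0 m)

  -- Bringing the letters i and j to the front of the word splits off (y+z)^p (x+z)^q.
  P′-at : ∀ s p q → P′ (at s p q) ≡ diag (weights s) p q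
  P′-at s p q = begin
    P′ (at s p q)
      ≡⟨ P′≡coefficient (at s p q) ⟩
    coefficient (baseWord (at s p q)) (at s p q)
      ≡⟨ coefficient-↭ word (at s p q) ⟩
    series s (coefficient (replicate p i ++ replicate q j ++ w)) 0 p q
      ≡⟨ series-word s w p q 0 p q ⟩
    powers p q (series s (coefficient w)) 0 p q
      -- The remaining word avoids i and j, so its factors involve x and y only through x+y.
      ≡⟨ resp-≈ (powers-multiplier p q) (λ r → R^-Merged r w-Merged s) 0 p q ⟩
    powers p q (merged (weights s)) 0 p q ∎
    where
    open ≡-Reasoning
    w = baseWord (at s 0 0)
    w-Merged : Merged (coefficient w)
    w-Merged = coefficient-Merged
      (baseWord-avoids (at s 0 0) i (trans (lookup∘update′ i≢j (s [ i ]≔ 0) 0) (lookup∘update i s 0)))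
      (baseWord-avoids (at s 0 0) j (lookup∘update j (s [ i ]≔ 0) 0))
    at-flip : ∀ a b → at s a b ≡ (s [ j ]≔ b) [ i ]≔ a
    at-flip a b = []≔-commutes s i j i≢j
    word : baseWord (at s p q) ↭ replicate p i ++ replicate q j ++ w
    word = ↭-trans (↭-reflexive (cong baseWord (at-flip p q)))
          (↭-trans (baseWord-replicate (s [ j ]≔ q) i p)
                   (++⁺ˡ (replicate p i) (↭-trans (↭-reflexive (cong baseWord (sym (at-flip 0 q))))
                                                  (baseWord-replicate (s [ i ]≔ 0) j q))))

  P′-exchange : ∀ s p q → P′ (at s p q) ≡ P′ (at s q p)
  P′-exchange s p q = trans (P′-at s p q) (trans (diag-sym (weights s) p q) (sym (P′-at s q p)))

  P′-transfer : ∀ s p q → q ≤ p → P′ (at s (suc p) q) ≤ P′ (at s p (suc q))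
  P′-transfer s p q q≤p =
    subst₂ _≤_ (sym (P′-at s (suc p) q)) (sym (P′-at s p (suc q))) (diag-transfer (weights s) p q q≤p)

-- Majorization

-- A discrete form of Schur concavity. Adjacent entries suffice, since exchanges generate all
-- permutations.
record Schur (Φ : List ℕ → ℕ) : Set where
  field
    exchange : ∀ pre p q suf → Φ (pre ++ p ∷ q ∷ suf) ≡ Φ (pre ++ q ∷ p ∷ suf)
    transfer : ∀ pre p q suf → q ≤ p → Φ (pre ++ suc p ∷ q ∷ suf) ≤ Φ (pre ++ p ∷ suc q ∷ suf)

open Schur

Schur-∷ : ∀ {Φ} x → Schur Φ → Schur (λ xs → Φ (x ∷ xs))
Schur-∷ x S .exchange pre = exchange S (x ∷ pre)
Schur-∷ x S .transfer pre = transfer S (x ∷ pre)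

Schur-↭ : ∀ {Φ xs ys} → Schur Φ → xs ↭ ys → Φ xs ≡ Φ ys
Schur-↭ S _↭_.refl         = refl
Schur-↭ S (prep x p)   = Schur-↭ (Schur-∷ x S) p
Schur-↭ S (swap x y p) = trans (exchange S [] x y _) (Schur-↭ (Schur-∷ x (Schur-∷ y S)) p)
Schur-↭ S (_↭_.trans p q)  = trans (Schur-↭ S p) (Schur-↭ S q)

-- `Dominates e as bs`: every partial sum of `as`, increased by `e`, is at least that of `bs`, with equality for
-- the full sums; the carries e′ are the differences of partial sums.
data Dominates : ℕ → List ℕ → List ℕ → Set where
  []   : Dominates 0 [] []
  cons : ∀ {e e′ x y as bs} → e + x ≡ e′ + y → Dominates e′ as bs → Dominates e (x ∷ as) (y ∷ bs)

-- The termination measure: each transfer made by `improve` lowers it.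
excess : ∀ {e as bs} → Dominates e as bs → ℕ
excess []                    = 0
excess (cons {e′ = e′} _ d) = e′ + excess d

-- The next carry is e + x ∸ y, where the case k = 1 shows that nothing is truncated.
partial-sums⇒Dominates : ∀ e as bs → length as ≡ length bs → e + sum as ≡ sum bs →
  (∀ k → k ≤ length bs → sum (take k bs) ≤ e + sum (take k as)) → Dominates e as bs
partial-sums⇒Dominates e [] [] _ eq _ with trans (sym (+-identityʳ e)) eq
... | refl = []
partial-sums⇒Dominates e (x ∷ as) (y ∷ bs) len eq le =
  cons (sym e′+y) (partial-sums⇒Dominates (e + x ∸ y) as bs (suc-injective len)
    (+-cancelˡ-≡ y _ _ (trans (move (sum as)) eq))
    (λ k k≤ → +-cancelˡ-≤ y _ _ (≤-trans (le (suc k) (s≤s k≤)) (≤-reflexive (sym (move (sum (take k as))))))))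
  where
  y≤e+x : y ≤ e + x
  y≤e+x = subst₂ _≤_ (+-identityʳ y) (cong (e +_) (+-identityʳ x)) (le 1 (s≤s z≤n))
  e′+y : e + x ∸ y + y ≡ e + x
  e′+y = m∸n+n≡m y≤e+x
  move : ∀ s → y + (e + x ∸ y + s) ≡ e + (x + s)
  move s = trans (sym (+-assoc y _ s)) (trans (cong (_+ s) (trans (+-comm y _) e′+y)) (+-assoc e x s))

Descending : List ℕ → Set
Descending = AllPairs (λ x y → y ≤ x)

-- As x > y, the next carry is positive, so a second entry exists. If it is below x, it receives one
-- unit from x and that carry drops by one; otherwise it exceeds its counterpart in the descending
-- `bs`, and the search continues there.
improve : ∀ {e x y as bs} (d : Dominates e (x ∷ as) (y ∷ bs)) → y < x → Descending (y ∷ bs) →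
  ∃ λ as′ → Σ (Dominates e as′ (y ∷ bs)) λ d′ → excess d′ < excess d × (∀ {Φ} → Schur Φ → Φ (x ∷ as) ≤ Φ as′)
improve {e} {x} {y} (cons {e′ = zero} eq d) y<x _ =
  ⊥-elim (<⇒≱ y<x (≤-trans (m≤n+m x e) (≤-reflexive eq)))
improve {e} {suc x} {y} (cons {e′ = suc e′} eq (cons {x = x₁} {as = as} eq₁ d)) (s≤s y≤x) ((y₁≤y ∷ _) ∷ desc) with x₁ ≤? x
... | yes x₁≤x =
  x ∷ suc x₁ ∷ as ,
  cons (suc-injective (trans (sym (+-suc e x)) eq)) (cons (trans (+-suc e′ x₁) eq₁) d) ,
  ≤-refl , λ S → transfer S [] x x₁ as x₁≤x
... | no x₁≰x with improve (cons eq₁ d) (≤-trans (s≤s (≤-trans y₁≤y y≤x)) (≰⇒> x₁≰x)) desc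
... | as′ , d′ , lt , mono = suc x ∷ as′ , cons eq d′ , +-monoʳ-< (suc e′) lt , λ S → mono (Schur-∷ (suc x) S)

Schur-Dominates : ∀ {Φ as bs} → Schur Φ → Descending bs → Dominates 0 as bs → Φ as ≤ Φ bs
Schur-Dominates S desc d = go (excess d) S desc d ≤-refl
  where
  go : ∀ {Φ as bs} fuel → Schur Φ → Descending bs → (d : Dominates 0 as bs) → excess d ≤ fuel → Φ as ≤ Φ bs
  go fuel S desc [] _ = ≤-refl
  go fuel S (_ ∷ desc) (cons {e′ = zero} {x = x} refl d) le = go fuel (Schur-∷ x S) desc d le
  -- The initial carry is 0, so a positive next carry says that the first entry of `as` exceeds that
  -- of `bs`.
  go (suc fuel) S desc d@(cons {e′ = suc e′} {y = y} refl _) le with improve d (s≤s (m≤n+m y e′)) desc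
  ... | as′ , d′ , lt , mono = ≤-trans (mono S) (go fuel S desc d′ (s≤s⁻¹ (≤-trans lt le)))

-- `F` is given for all lengths at once, so that a leading entry can be absorbed into it in the
-- induction on a prefix.
record VecSchur (F : ∀ {n} → Vec ℕ n → ℕ) : Set where
  field
    vec-exchange : ∀ {n} (i j : Fin n) → i ≢ j → ∀ s p q → F ((s [ i ]≔ p) [ j ]≔ q) ≡ F ((s [ i ]≔ q) [ j ]≔ p)
    vec-transfer : ∀ {n} (i j : Fin n) → i ≢ j → ∀ s p q → q ≤ p →
      F ((s [ i ]≔ suc p) [ j ]≔ q) ≤ F ((s [ i ]≔ p) [ j ]≔ suc q)

open VecSchur

VecSchur-∷ : {F : ∀ {n} → Vec ℕ n → ℕ} → ∀ x → VecSchur F → VecSchur (λ t → F (x ∷ t))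
VecSchur-∷ x V .vec-exchange i j i≢j s = vec-exchange V (suc i) (suc j) (i≢j ∘ Fin.suc-injective) (x ∷ s)
VecSchur-∷ x V .vec-transfer i j i≢j s = vec-transfer V (suc i) (suc j) (i≢j ∘ Fin.suc-injective) (x ∷ s)

VecSchur⇒Schur : {F : ∀ {n} → Vec ℕ n → ℕ} → VecSchur F → Schur (λ xs → F (fromList xs))
VecSchur⇒Schur V .exchange []        p q suf = vec-exchange V zero (suc zero) (λ ()) (p ∷ q ∷ fromList suf) p q
VecSchur⇒Schur {F} V .exchange (x ∷ pre) =
  exchange (VecSchur⇒Schur {λ t → F (x ∷ t)} (VecSchur-∷ {F} x V)) pre
VecSchur⇒Schur V .transfer []        p q suf = vec-transfer V zero (suc zero) (λ ()) (p ∷ q ∷ fromList suf) p q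
VecSchur⇒Schur {F} V .transfer (x ∷ pre) =
  transfer (VecSchur⇒Schur {λ t → F (x ∷ t)} (VecSchur-∷ {F} x V)) pre

P′-Schur : Schur (λ xs → P′ (fromList xs))
P′-Schur = VecSchur⇒Schur {P′} record
  { vec-exchange = Pair.P′-exchange
  ; vec-transfer = Pair.P′-transfer
  }

-- The two vectors have different length indices, so they are compared through a function defined
-- for all lengths.
fromList∘toList : (F : ∀ {n} → Vec A n → B) (t : Vec A n) → F (fromList (toList t)) ≡ F t
fromList∘toList F []      = refl
fromList∘toList F (x ∷ t) = fromList∘toList (λ t → F (x ∷ t)) t

-- Sorting in descending order

AllPairs-reverse : {R : A → A → Set} {xs : List A} → AllPairs R xs → AllPairs (flip R) (reverse xs)
AllPairs-reverse [] = []
AllPairs-reverse {xs = x ∷ xs} (px ∷ pxs) rewrite unfold-reverse x xs =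
  AllPairs.++⁺ (AllPairs-reverse pxs) ([] ∷ []) (All.map (_∷ []) (All-resp-↭ (↭-sym (↭-reverse xs)) px))

sortDesc-↭ : ∀ xs → sortDesc xs ↭ xs
sortDesc-↭ xs = ↭-trans (↭-reverse (sort xs)) (sort-↭ xs)

sortDesc-Descending : ∀ xs → Descending (sortDesc xs)
sortDesc-Descending xs = AllPairs-reverse (Sorted⇒AllPairs ≤-totalOrder (sort-↗ xs))

length-sortDesc : (t : Vec ℕ n) → length (sortDesc (toList t)) ≡ n
length-sortDesc t = trans (↭-length (sortDesc-↭ (toList t))) (length-toList t)

Majorizes⇒Dominates : (a b : Vec ℕ n) → Majorizes a b → Dominates 0 (sortDesc (toList a)) (sortDesc (toList b))
Majorizes⇒Dominates a b (sums , partials) = partial-sums⇒Dominates 0 _ _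
  (trans (length-sortDesc a) (sym (length-sortDesc b)))
  (trans (sum-↭ (sortDesc-↭ (toList a))) (trans sums (sym (sum-↭ (sortDesc-↭ (toList b))))))
  (λ k k≤ → partials k (≤-trans k≤ (≤-reflexive (length-sortDesc b))))

P′-sortDesc : (t : Vec ℕ n) → P′ t ≡ P′ (fromList (sortDesc (toList t)))
P′-sortDesc t = trans (sym (fromList∘toList P′ t)) (sym (Schur-↭ P′-Schur (sortDesc-↭ (toList t))))

theorem4p3 : (n : ℕ) (a b : Vec ℕ n) → Majorizes a b → P′ a ≤ P′ b
theorem4p3 n a b maj = subst₂ _≤_ (sym (P′-sortDesc a)) (sym (P′-sortDesc b))
  (Schur-Dominates P′-Schur (sortDesc-Descending (toList b)) (Majorizes⇒Dominates a b maj))
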